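{- There is an absolute constant $c>0$ such that the following holds. Let $k\geq 2$ be an integer and let $A=\{a_1<\cdots<a_N\}$ be a finite set of real numbers which is $k$-convex. Then \[ |2^{k}A-(2^{k}-1)A|\geq c\,\frac{|A|^{k+1}}{2^{k^2}}. \]
   Context: For a set $A\subset\mathbb{R}$ and nonnegative integers $m,n$, $mA-nA=\{(x_1+\cdots+x_m)-(x_{m+1}+\cdots+x_{m+n}):x_1,\ldots,x_{m+n}\in A\}$. A finite set $A=\{a_1<\cdots<a_N\}$ of reals is regarded as the sequence of its elements in increasing order. Such a sequence is called $1$-convex (convex) if its sequence of first differences $a_{i+1}-a_i$, $1\leq i\leq N-1$, is strictly increasing. Inductively, for $k\geq 2$, the increasing sequence $a_1<\cdots<a_N$ is called $k$-convex if its sequence of first differences $(a_{i+1}-a_i)_{1\le i\le N-1}$ is $(k-1)$-convex (in particular this difference sequence is itself strictly increasing). -}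

module Defs where

open import Data.Fin as Fin using (Fin; inject₁)
open import Data.Integer using () renaming (+_ to pos)
open import Data.Nat as ℕ using (ℕ; zero; suc; _⊔_)
import Data.Nat.Properties as ℕₚ
open import Data.Product using (Σ; ∃; _×_; _,_; proj₁)
open import Data.Rational as ℚ using (ℚ; 0ℚ; 1ℚ; ½; 1/_; ∣_∣; Positive)
import Data.Rational.Properties as ℚₚ
open import Data.Rational.Solver using (module +-*-Solver)
open import Data.Vec.Functional using (Vector; foldr)
open import Function.Bundles using (Injection)
open import Level using (0ℓ)
open import Relation.Binary.Bundles using (Setoid)
import Relation.Binary.Construct.On as On
open import Relation.Binary.PropositionalEquality
  using (_≡_; refl; sym; cong; subst; setoid; module ≡-Reasoning)
open import Relation.Nullary using (¬_)
open import Relation.Unary using (Pred; _∈_)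

open +-*-Solver using (solve; _:+_; _:*_; _:-_; :-_; _:=_; con)

-- Real numbers: Cauchy sequences of rationals with a modulus of
-- convergence, under the usual equivalence.

IsCauchy : (ℕ → ℚ) → Set
IsCauchy x = ∀ ε → 0ℚ ℚ.< ε →
  ∃ λ M → ∀ m n → M ℕ.≤ m → M ℕ.≤ n → ∣ x m ℚ.- x n ∣ ℚ.< ε

record ℝ : Set where
  constructor mkℝ
  field
    seq    : ℕ → ℚ
    cauchy : IsCauchy seq

open ℝ public

infix 4 _≈_ _<_ _≤_

_≈_ : ℝ → ℝ → Set
x ≈ y = ∀ ε → 0ℚ ℚ.< ε →
  ∃ λ M → ∀ n → M ℕ.≤ n → ∣ seq x n ℚ.- seq y n ∣ ℚ.< ε

_<_ : ℝ → ℝ → Set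
x < y = ∃ λ ε → 0ℚ ℚ.< ε ×
  ∃ λ M → ∀ n → M ℕ.≤ n → seq x n ℚ.+ ε ℚ.≤ seq y n

_≤_ : ℝ → ℝ → Set
x ≤ y = ¬ (y < x)

private

  half-pos : ∀ {ε} → 0ℚ ℚ.< ε → 0ℚ ℚ.< ½ ℚ.* ε
  half-pos {ε} 0<ε =
    subst (ℚ._< ½ ℚ.* ε) (ℚₚ.*-zeroʳ ½) (ℚₚ.*-monoʳ-<-pos ½ 0<ε)

  half+half : ∀ ε → ½ ℚ.* ε ℚ.+ ½ ℚ.* ε ≡ ε
  half+half = solve 1 (λ ε → con ½ :* ε :+ con ½ :* ε := ε) refl

  -- Two contributions, each eventually below ε/2, sum to below ε.
  halves : ∀ {p q r ε} → ∣ p ∣ ℚ.< ½ ℚ.* ε → ∣ q ∣ ℚ.< ½ ℚ.* ε →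
           p ℚ.+ q ≡ r → ∣ r ∣ ℚ.< ε
  halves {p} {q} {_} {ε} p< q< refl = ℚₚ.≤-<-trans (ℚₚ.∣p+q∣≤∣p∣+∣q∣ p q)
    (subst (∣ p ∣ ℚ.+ ∣ q ∣ ℚ.<_) (half+half ε) (ℚₚ.+-mono-< p< q<))

  neg-diff : ∀ p q → ℚ.- p ℚ.- (ℚ.- q) ≡ ℚ.- (p ℚ.- q)
  neg-diff = solve 2 (λ p q → :- p :- (:- q) := :- (p :- q)) refl

  swap-diff : ∀ p q → ∣ p ℚ.- q ∣ ≡ ∣ q ℚ.- p ∣
  swap-diff p q rewrite sym (ℚₚ.∣-p∣≡∣p∣ (p ℚ.- q)) =
    cong ∣_∣ (solve 2 (λ p q → :- (p :- q) := q :- p) refl p q)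

  self-diff : ∀ p {ε} → 0ℚ ℚ.< ε → ∣ p ℚ.- p ∣ ℚ.< ε
  self-diff p 0<ε rewrite ℚₚ.+-inverseʳ p = 0<ε

  add-diff : ∀ p q r s → (p ℚ.- r) ℚ.+ (q ℚ.- s) ≡ (p ℚ.+ q) ℚ.- (r ℚ.+ s)
  add-diff = solve 4 (λ p q r s →
    (p :- r) :+ (q :- s) := (p :+ q) :- (r :+ s)) refl

  mul-diff : ∀ p q r s →
             p ℚ.* (q ℚ.- s) ℚ.+ s ℚ.* (p ℚ.- r) ≡ p ℚ.* q ℚ.- r ℚ.* s
  mul-diff = solve 4 (λ p q r s →
    p :* (q :- s) :+ s :* (p :- r) := p :* q :- r :* s) refl

  EventuallyBounded : (ℕ → ℚ) → Set
  EventuallyBounded x =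
    Σ ℚ λ B → Positive B × ∃ λ M → ∀ n → M ℕ.≤ n → ∣ x n ∣ ℚ.≤ B

  bounded : ∀ x → EventuallyBounded (seq x)
  bounded x with cauchy x 1ℚ (ℚₚ.positive⁻¹ 1ℚ)
  ... | M , close = ∣ seq x M ∣ ℚ.+ 1ℚ
      , ℚₚ.nonNeg+pos⇒pos ∣ seq x M ∣
          {{ℚ.nonNegative (ℚₚ.0≤∣p∣ (seq x M))}} 1ℚ
      , M , λ n M≤n → ℚₚ.≤-trans
          (subst (λ t → ∣ t ∣ ℚ.≤ ∣ seq x M ∣ ℚ.+ ∣ seq x n ℚ.- seq x M ∣)
            (solve 2 (λ p q → p :+ (q :- p) := q) refl (seq x M) (seq x n))
            (ℚₚ.∣p+q∣≤∣p∣+∣q∣ (seq x M) (seq x n ℚ.- seq x M)))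
          (ℚₚ.+-monoʳ-≤ ∣ seq x M ∣
            (ℚₚ.<⇒≤ (close n M M≤n ℕₚ.≤-refl)))

  module _ (B : ℚ) {{B>0 : Positive B}} where

    private instance
      B≢0 : ℚ.NonZero B
      B≢0 = ℚₚ.pos⇒nonZero B

    shrink : ℚ → ℚ
    shrink ε = 1/ B ℚ.* ε

    shrink-pos : ∀ {ε} → 0ℚ ℚ.< ε → 0ℚ ℚ.< shrink ε
    shrink-pos {ε} 0<ε = subst (ℚ._< shrink ε) (ℚₚ.*-zeroʳ (1/ B))
      (ℚₚ.*-monoʳ-<-pos (1/ B) {{ℚₚ.1/pos⇒pos B}} 0<ε)

    *-shrink : ∀ {p q ε} → ∣ p ∣ ℚ.≤ B → ∣ q ∣ ℚ.< shrink ε →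
               ∣ p ℚ.* q ∣ ℚ.< ε
    *-shrink {p} {q} {ε} p≤ q< = begin-strict
      ∣ p ℚ.* q ∣          ≡⟨ ℚₚ.∣p*q∣≡∣p∣*∣q∣ p q ⟩
      ∣ p ∣ ℚ.* ∣ q ∣      ≤⟨ ℚₚ.*-monoʳ-≤-nonNeg ∣ q ∣
                                {{ℚ.nonNegative (ℚₚ.0≤∣p∣ q)}} p≤ ⟩
      B ℚ.* ∣ q ∣          <⟨ ℚₚ.*-monoʳ-<-pos B q< ⟩
      B ℚ.* (1/ B ℚ.* ε)   ≡⟨ ℚₚ.*-assoc B (1/ B) ε ⟨
      (B ℚ.* 1/ B) ℚ.* ε   ≡⟨ cong (ℚ._* ε) (ℚₚ.*-inverseʳ B) ⟩
      1ℚ ℚ.* ε             ≡⟨ ℚₚ.*-identityˡ ε ⟩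
      ε                    ∎
      where open ℚₚ.≤-Reasoning

  ⊔-left : ∀ {m n o} → m ⊔ n ℕ.≤ o → m ℕ.≤ o
  ⊔-left {m} {n} = ℕₚ.≤-trans (ℕₚ.m≤m⊔n m n)

  ⊔-right : ∀ {m n o} → m ⊔ n ℕ.≤ o → n ℕ.≤ o
  ⊔-right {m} {n} = ℕₚ.≤-trans (ℕₚ.m≤n⊔m m n)

ℝ-setoid : Setoid 0ℓ 0ℓ
ℝ-setoid = record
  { Carrier = ℝ
  ; _≈_ = _≈_
  ; isEquivalence = record
    { refl  = λ {x} ε 0<ε → 0 , λ n _ → self-diff (seq x n) 0<ε
    ; sym   = λ {x} {y} x≈y ε 0<ε → let M , close = x≈y ε 0<ε in
        M , λ n M≤n → subst (ℚ._< ε) (swap-diff (seq x n) (seq y n))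
                        (close n M≤n)
    ; trans = λ {x} {y} {z} x≈y y≈z ε 0<ε →
        let M , close  = x≈y (½ ℚ.* ε) (half-pos 0<ε)
            L , close′ = y≈z (½ ℚ.* ε) (half-pos 0<ε)
        in M ⊔ L , λ n le →
             halves (close n (⊔-left le)) (close′ n (⊔-right {M} le))
               (solve 3 (λ p q r → (p :- q) :+ (q :- r) := p :- r) refl
                 (seq x n) (seq y n) (seq z n))
    }
  }

infixl 7 _*_
infixl 6 _+_ _-_
infix  8 -_

fromℚ : ℚ → ℝ
fromℚ q = mkℝ (λ _ → q) λ ε 0<ε → 0 , λ _ _ _ _ → self-diff q 0<ε

fromℕ : ℕ → ℝ
fromℕ n = fromℚ (pos n ℚ./ 1)

0ℝ : ℝ
0ℝ = fromℚ 0ℚ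

_+_ : ℝ → ℝ → ℝ
x + y = mkℝ (λ n → seq x n ℚ.+ seq y n) λ ε 0<ε →
  let M , close  = cauchy x (½ ℚ.* ε) (half-pos 0<ε)
      L , close′ = cauchy y (½ ℚ.* ε) (half-pos 0<ε)
  in M ⊔ L , λ m n m≥ n≥ →
       halves (close m n (⊔-left m≥) (⊔-left n≥))
              (close′ m n (⊔-right {M} m≥) (⊔-right {M} n≥))
              (add-diff (seq x m) (seq y m) (seq x n) (seq y n))

-_ : ℝ → ℝ
- x = mkℝ (λ n → ℚ.- seq x n) λ ε 0<ε →
  let M , close = cauchy x ε 0<ε
  in M , λ m n m≥ n≥ → ℚₚ.≤-<-trans
       (ℚₚ.≤-reflexive (begin
         ∣ ℚ.- seq x m ℚ.- (ℚ.- seq x n) ∣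
           ≡⟨ cong ∣_∣ (neg-diff (seq x m) (seq x n)) ⟩
         ∣ ℚ.- (seq x m ℚ.- seq x n) ∣
           ≡⟨ ℚₚ.∣-p∣≡∣p∣ (seq x m ℚ.- seq x n) ⟩
         ∣ seq x m ℚ.- seq x n ∣ ∎))
       (close m n m≥ n≥)
  where open ≡-Reasoning

_-_ : ℝ → ℝ → ℝ
x - y = x + - y

_*_ : ℝ → ℝ → ℝ
x * y = mkℝ (λ n → seq x n ℚ.* seq y n) λ ε 0<ε →
  let B , B>0 , K , x≤B = bounded x
      C , C>0 , J , y≤C = bounded y
      M , close  = cauchy y (shrink B {{B>0}} (½ ℚ.* ε))
                     (shrink-pos B {{B>0}} (half-pos 0<ε))
      L , close′ = cauchy x (shrink C {{C>0}} (½ ℚ.* ε))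
                     (shrink-pos C {{C>0}} (half-pos 0<ε))
  in (K ⊔ J) ⊔ (M ⊔ L) , λ m n m≥ n≥ →
       halves
         (*-shrink B {{B>0}} (x≤B m (⊔-left (⊔-left m≥)))
           (close m n (⊔-left (⊔-right {K ⊔ J} m≥))
                      (⊔-left (⊔-right {K ⊔ J} n≥))))
         (*-shrink C {{C>0}} (y≤C n (⊔-right {K} (⊔-left n≥)))
           (close′ m n (⊔-right {M} (⊔-right {K ⊔ J} m≥))
                       (⊔-right {M} (⊔-right {K ⊔ J} n≥))))
         (mul-diff (seq x m) (seq y m) (seq x n) (seq y n))

StrictlyIncreasing : ∀ {N} → Vector ℝ N → Set
StrictlyIncreasing a = ∀ i j → i Fin.< j → a i < a j

Δ : ∀ {N} → Vector ℝ N → Vector ℝ (ℕ.pred N)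
Δ {suc N} a i = a (Fin.suc i) - a (inject₁ i)

-- The recursion starts at 0-convex = strictly increasing, so that
-- 1-convex says that a and its differences are strictly increasing.
IsConvex : ℕ → ∀ {N} → Vector ℝ N → Set
IsConvex zero    a = StrictlyIncreasing a
IsConvex (suc k) a = StrictlyIncreasing a × IsConvex k (Δ a)

SetOfReals : Set₁
SetOfReals = Pred ℝ 0ℓ

elements : ∀ {N} → Vector ℝ N → SetOfReals
elements a x = ∃ λ i → x ≈ a i

sum : ∀ {m} → Vector ℝ m → ℝ
sum = foldr _+_ 0ℝ

-- sumDifferenceSet m n A is mA − nA.
sumDifferenceSet : ℕ → ℕ → SetOfReals → SetOfReals
sumDifferenceSet m n A z =
  ∃ λ (x : Vector ℝ m) → ∃ λ (y : Vector ℝ n) →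
    (∀ i → x i ∈ A) × (∀ j → y j ∈ A) × z ≈ sum x - sum y

subsetSetoid : SetOfReals → Setoid 0ℓ 0ℓ
subsetSetoid S = On.setoid {B = Σ ℝ S} ℝ-setoid proj₁

-- Equality of reals is undecidable, so the exact number of elements of a
-- finite set of reals need not be computable; a lower bound r on it is
-- witnessed by an injection from Fin n with r ≤ n.
infix 4 ∣_∣≥_

∣_∣≥_ : SetOfReals → ℝ → Set
∣ S ∣≥ r = ∃ λ n → r ≤ fromℕ n × Injection (setoid (Fin n)) (subsetSetoid S)

-- Strengthen the claim so that the induction stays inside one interval: for a
-- k-convex sequence a₀ < … < a_M, the set 2ᵏA − (2ᵏ−1)A has at least
-- C(M, k+1) elements in (a₀ , a_M].  For the last interval, Δa is
-- (k−1)-convex and ends with a_M − a_(M−1), so it gives C(M−1, k) elements z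
-- of 2ᵏ⁻¹ΔA − (2ᵏ⁻¹−1)ΔA in (0 , a_M − a_(M−1)]; the shifts a_(M−1) + z lie in
-- 2ᵏA − (2ᵏ−1)A and in (a_(M−1) , a_M].  The other intervals are covered by
-- the initial segment of a, and Pascal's rule adds up the counts.
module Submission where

open import Defs
open import Data.Fin as Fin using (Fin; inject₁; splitAt; join)
import Data.Fin.Properties as Finₚ
open import Data.Integer as ℤ using (+_)
import Data.Integer.Properties as ℤₚ
open import Data.Nat as ℕ using (ℕ; zero; suc; _∸_; _^_; z≤n; s≤s) renaming (_≤_ to _≤ℕ_)
open import Data.Nat.Combinatorics using (_C_; nC1≡n; nCk+nC[k+1]≡[n+1]C[k+1])
open import Data.Nat.Properties as ℕₚ using (m^n≢0)
import Data.Nat.Tactic.RingSolver as ℕSolver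
open import Data.Product using (∃; _×_; _,_; proj₁; proj₂)
open import Data.Rational as ℚ using (ℚ; 0ℚ; ½; _/_; toℚᵘ)
import Data.Rational.Properties as ℚₚ
open import Data.Rational.Solver using (module +-*-Solver)
import Data.Rational.Unnormalised as ℚᵘ
import Data.Rational.Unnormalised.Properties as ℚᵘₚ
open import Data.Sum using (_⊎_; inj₁; inj₂; [_,_]′)
open import Data.Vec.Functional using (Vector; _∷_; _++_; init; last)
open import Function using (_∘_)
open import Function.Bundles using (Injection)
open import Relation.Binary.Bundles using (Setoid)
open import Relation.Binary.PropositionalEquality
open import Relation.Nullary using (¬_; contradiction)
open import Relation.Unary using (_∈_; _⊆_)

open +-*-Solver using (solve; _:+_; _:*_; _:-_; :-_; _:=_; con)
open Setoid ℝ-setoid using () renaming (refl to ≈-refl; sym to ≈-sym; trans to ≈-trans)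

-- Arithmetic and order of Cauchy reals

-- `_≈_` sees only termwise differences, so a ring identity between rationals turns one equivalence
-- into another.
≈-transport : ∀ {x y x′ y′} →
  (∀ n → seq x n ℚ.- seq y n ≡ seq x′ n ℚ.- seq y′ n) → x ≈ y → x′ ≈ y′
≈-transport eq x≈y ε 0<ε = let M , close = x≈y ε 0<ε in
  M , λ n M≤n → subst (λ t → ℚ.∣ t ∣ ℚ.< ε) (eq n) (close n M≤n)

≈-pointwise : ∀ {x y} → (∀ n → seq x n ≡ seq y n) → x ≈ y
≈-pointwise {x} {y} eq = ≈-transport {x} {x} {x} {y}
  (λ n → cong (ℚ._-_ (seq x n)) (eq n)) (≈-refl {x})

+-cancelˡ : ∀ {x y} z → z + x ≈ z + y → x ≈ y
+-cancelˡ {x} {y} z = ≈-transport {z + x} {z + y} {x} {y}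
  λ n → solve 3 (λ x y z → (z :+ x) :- (z :+ y) := x :- y) refl (seq x n) (seq y n) (seq z n)

-‿cong : ∀ {x y} → x ≈ y → - x ≈ - y
-‿cong {x} {y} x≈y = ≈-transport {y} {x} { - x} { - y}
  (λ n → solve 2 (λ x y → y :- x := :- x :- :- y) refl (seq x n) (seq y n)) (≈-sym {x} {y} x≈y)

-- Adding `t n` on both sides leaves the gap ε intact; with `t` the terms of a real or of its
-- negative, a summand moves across the inequality.
<-translate : ∀ {x y x′ y′} (t : ℕ → ℚ) →
  (∀ n → t n ℚ.+ seq x n ≡ seq x′ n) → (∀ n → t n ℚ.+ seq y n ≡ seq y′ n) → x < y → x′ < y′
<-translate {x} t eqx eqy (ε , 0<ε , M , gap) = ε , 0<ε , M , λ n M≤n →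
  subst₂ ℚ._≤_
    (trans (sym (ℚₚ.+-assoc (t n) (seq x n) ε)) (cong (ℚ._+ ε) (eqx n)))
    (eqy n)
    (ℚₚ.+-monoʳ-≤ (t n) (gap n M≤n))

x<y⇒0<y-x : ∀ {x y} → x < y → 0ℝ < y - x
x<y⇒0<y-x {x} {y} = <-translate {x} {y} {0ℝ} {y - x} (λ n → ℚ.- seq x n)
  (λ n → ℚₚ.+-inverseˡ (seq x n)) (λ n → ℚₚ.+-comm (ℚ.- seq x n) (seq y n))

0<y⇒x<x+y : ∀ x {y} → 0ℝ < y → x < x + y
0<y⇒x<x+y x {y} = <-translate {0ℝ} {y} {x} {x + y} (seq x)
  (λ n → ℚₚ.+-identityʳ (seq x n)) (λ _ → refl)

y<x+z⇒y-x<z : ∀ x {y z} → y < x + z → y - x < z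
y<x+z⇒y-x<z x {y} {z} = <-translate {y} {x + z} {y - x} {z} (λ n → ℚ.- seq x n)
  (λ n → ℚₚ.+-comm (ℚ.- seq x n) (seq y n))
  (λ n → solve 2 (λ x z → :- x :+ (x :+ z) := z) refl (seq x n) (seq z n))

p≤p+ε : ∀ p {ε} → 0ℚ ℚ.< ε → p ℚ.≤ p ℚ.+ ε
p≤p+ε p {ε} 0<ε = subst (ℚ._≤ p ℚ.+ ε) (ℚₚ.+-identityʳ p) (ℚₚ.+-monoʳ-≤ p (ℚₚ.<⇒≤ 0<ε))

<-trans : ∀ {x y z} → x < y → y < z → x < z
<-trans {x} {y} (ε , 0<ε , M , gap) (δ , 0<δ , L , gap′) = ε , 0<ε , M ℕ.⊔ L , λ n le →
  ℚₚ.≤-trans (gap n (ℕₚ.m⊔n≤o⇒m≤o M L le))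
    (ℚₚ.≤-trans (p≤p+ε (seq y n) 0<δ) (gap′ n (ℕₚ.m⊔n≤o⇒n≤o M L le)))

fromℚ-cancel-< : ∀ {p q} → fromℚ p < fromℚ q → p ℚ.< q
fromℚ-cancel-< {p} {q} (ε , 0<ε , M , gap) = ℚₚ.<-≤-trans
  (subst (ℚ._< p ℚ.+ ε) (ℚₚ.+-identityʳ p) (ℚₚ.+-monoʳ-< p 0<ε)) (gap M ℕₚ.≤-refl)

<-irrefl : ∀ {x} → ¬ x < x
<-irrefl {x} (ε , 0<ε , M , gap) = ℚₚ.<-irrefl refl
  (fromℚ-cancel-< {seq x M} {seq x M} (ε , 0<ε , 0 , λ _ _ → gap M ℕₚ.≤-refl))

-- Eventually `z` is within ε/2 of `y`, so half of the gap ε survives.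
<-respʳ-≈ : ∀ {x y z} → y ≈ z → x < y → x < z
<-respʳ-≈ {x} {y} {z} y≈z (ε , 0<ε , M , gap) = ½ ℚ.* ε , 0<½ε , M ℕ.⊔ proj₁ (y≈z _ 0<½ε) , λ n le →
  let open ℚₚ.≤-Reasoning
      L , close = y≈z (½ ℚ.* ε) 0<½ε
      p = seq x n
      q = seq y n
      r = seq z n
  in begin
    p ℚ.+ ½ ℚ.* ε                                   ≡⟨ solve 2 (λ p ε → p :+ con ½ :* ε := p :+ ε :- con ½ :* ε) refl p ε ⟩
    p ℚ.+ ε ℚ.- ½ ℚ.* ε                             ≤⟨ ℚₚ.+-mono-≤ (gap n (ℕₚ.m⊔n≤o⇒m≤o M L le))
                                                          (ℚₚ.neg-antimono-≤ (ℚₚ.<⇒≤ (close n (ℕₚ.m⊔n≤o⇒n≤o M L le)))) ⟩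
    q ℚ.- ℚ.∣ q ℚ.- r ∣                             ≤⟨ ℚₚ.+-monoʳ-≤ q (ℚₚ.neg-antimono-≤ (p≤∣p∣ (q ℚ.- r))) ⟩
    q ℚ.- (q ℚ.- r)                                 ≡⟨ solve 2 (λ q r → q :- (q :- r) := r) refl q r ⟩
    r                                               ∎
  where
  0<½ε : 0ℚ ℚ.< ½ ℚ.* ε
  0<½ε = subst (ℚ._< ½ ℚ.* ε) (ℚₚ.*-zeroʳ ½) (ℚₚ.*-monoʳ-<-pos ½ 0<ε)
  p≤∣p∣ : ∀ p → p ℚ.≤ ℚ.∣ p ∣
  p≤∣p∣ p with ℚₚ.≤-total 0ℚ p
  ... | inj₁ 0≤p = ℚₚ.≤-reflexive (sym (ℚₚ.0≤p⇒∣p∣≡p 0≤p))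
  ... | inj₂ p≤0 = ℚₚ.≤-trans p≤0 (ℚₚ.0≤∣p∣ p)

-- Closure properties of sum-difference sets

sumDifferenceSet-resp-≈ : ∀ {m n A z w} →
  z ≈ w → w ∈ sumDifferenceSet m n A → z ∈ sumDifferenceSet m n A
sumDifferenceSet-resp-≈ {z = z} {w} z≈w (x , y , x∈A , y∈A , w≈) =
  x , y , x∈A , y∈A , ≈-trans {z} {w} {sum x - sum y} z≈w w≈

sumDifferenceSet-mono : ∀ {m n A B} → A ⊆ B → sumDifferenceSet m n A ⊆ sumDifferenceSet m n B
sumDifferenceSet-mono A⊆B (x , y , x∈A , y∈A , z≈) =
  x , y , (λ i → A⊆B (x∈A i)) , (λ j → A⊆B (y∈A j)) , z≈

∷-∈ : ∀ {A : SetOfReals} {n x} {xs : Vector ℝ n} →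
  x ∈ A → (∀ i → xs i ∈ A) → ∀ i → (x ∷ xs) i ∈ A
∷-∈ x∈A xs∈A Fin.zero    = x∈A
∷-∈ x∈A xs∈A (Fin.suc i) = xs∈A i

sumDifferenceSet-+ : ∀ {m n A a z} →
  a ∈ A → z ∈ sumDifferenceSet m n A → a + z ∈ sumDifferenceSet (suc m) n A
sumDifferenceSet-+ {A = A} {a} {z} a∈A (x , y , x∈A , y∈A , z≈) =
  a ∷ x , y , ∷-∈ {A} a∈A x∈A , y∈A ,
  ≈-transport {z} {sum x - sum y} {a + z} {a + sum x - sum y}
    (λ n → solve 4 (λ a z x y → z :- (x :- y) := (a :+ z) :- ((a :+ x) :- y)) refl
      (seq a n) (seq z n) (seq (sum x) n) (seq (sum y) n)) z≈

sumDifferenceSet-- : ∀ {m n A a z} →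
  a ∈ A → z ∈ sumDifferenceSet m n A → z - a ∈ sumDifferenceSet m (suc n) A
sumDifferenceSet-- {A = A} {a} {z} a∈A (x , y , x∈A , y∈A , z≈) =
  x , a ∷ y , x∈A , ∷-∈ {A} a∈A y∈A ,
  ≈-transport {z} {sum x - sum y} {z - a} {sum x - (a + sum y)}
    (λ n → solve 4 (λ a z x y → z :- (x :- y) := (z :- a) :- (x :- (a :+ y))) refl
      (seq a n) (seq z n) (seq (sum x) n) (seq (sum y) n)) z≈

-- A difference of consecutive terms lies in A − A, so each one used costs one
-- summand and one subtrahend from A.
module _ {N} (a : Vector ℝ (suc N)) where

  private
    A = elements a
    D = elements (Δ a)

  elements⊆sumDifferenceSet : ∀ i → a i ∈ sumDifferenceSet 1 0 A
  elements⊆sumDifferenceSet i =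
    (λ _ → a i) , (λ ()) , (λ _ → i , ≈-refl {a i}) , (λ ()) ,
    ≈-pointwise {a i} {a i + 0ℝ - 0ℝ} λ n →
      solve 1 (λ a → a := (a :+ con 0ℚ) :- con 0ℚ) refl (seq (a i) n)

  Δ-+ : ∀ {m n d z} → d ∈ D → z ∈ sumDifferenceSet m n A → z + d ∈ sumDifferenceSet (suc m) (suc n) A
  Δ-+ {m} {n} {d} {z} (i , d≈) z∈ = sumDifferenceSet-resp-≈ {suc m} {suc n} {A} {z + d} {a₁ + z - a₀}
    (≈-transport {d} {a₁ - a₀} {z + d} {a₁ + z - a₀}
      (λ n → solve 4 (λ d z a₁ a₀ → d :- (a₁ :- a₀) := (z :+ d) :- ((a₁ :+ z) :- a₀)) refl
        (seq d n) (seq z n) (seq a₁ n) (seq a₀ n)) d≈)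
    (sumDifferenceSet-- {suc m} {n} {A} {a₀} {a₁ + z} (inject₁ i , ≈-refl {a₀})
      (sumDifferenceSet-+ {m} {n} {A} {a₁} {z} (Fin.suc i , ≈-refl {a₁}) z∈))
    where
    a₀ = a (inject₁ i)
    a₁ = a (Fin.suc i)

  Δ-- : ∀ {m n d z} → d ∈ D → z ∈ sumDifferenceSet m n A → z - d ∈ sumDifferenceSet (suc m) (suc n) A
  Δ-- {m} {n} {d} {z} (i , d≈) z∈ = sumDifferenceSet-resp-≈ {suc m} {suc n} {A} {z - d} {a₀ + z - a₁}
    (≈-transport { - d} { - (a₁ - a₀)} {z - d} {a₀ + z - a₁}
      (λ n → solve 4 (λ d z a₁ a₀ → :- d :- (:- (a₁ :- a₀)) := (z :- d) :- ((a₀ :+ z) :- a₁)) refl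
        (seq d n) (seq z n) (seq a₁ n) (seq a₀ n)) (-‿cong {d} {a₁ - a₀} d≈))
    (sumDifferenceSet-- {suc m} {n} {A} {a₁} {a₀ + z} (Fin.suc i , ≈-refl {a₁})
      (sumDifferenceSet-+ {m} {n} {A} {a₀} {z} (inject₁ i , ≈-refl {a₀}) z∈))
    where
    a₀ = a (inject₁ i)
    a₁ = a (Fin.suc i)

  Δ-+-sum : ∀ {m n l z} (x : Vector ℝ l) → (∀ i → x i ∈ D) →
    z ∈ sumDifferenceSet m n A → z + sum x ∈ sumDifferenceSet (l ℕ.+ m) (l ℕ.+ n) A
  Δ-+-sum {m} {n} {zero} {z} x x∈D z∈ = sumDifferenceSet-resp-≈ {m} {n} {A} {z + 0ℝ} {z}
    (≈-pointwise {z + 0ℝ} {z} λ n → ℚₚ.+-identityʳ (seq z n)) z∈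
  Δ-+-sum {m} {n} {suc l} {z} x x∈D z∈ =
    sumDifferenceSet-resp-≈ {suc l ℕ.+ m} {suc l ℕ.+ n} {A} {z + (x₀ + sum x′)} {z + sum x′ + x₀}
      (≈-pointwise {z + (x₀ + sum x′)} {z + sum x′ + x₀} λ n →
        solve 3 (λ z x s → z :+ (x :+ s) := (z :+ s) :+ x) refl (seq z n) (seq x₀ n) (seq (sum x′) n))
      (Δ-+ {l ℕ.+ m} {l ℕ.+ n} {x₀} {z + sum x′} (x∈D Fin.zero)
        (Δ-+-sum {m} {n} {l} {z} x′ (x∈D ∘ Fin.suc) z∈))
    where
    x₀ = x Fin.zero
    x′ = x ∘ Fin.suc

  Δ---sum : ∀ {m n l z} (x : Vector ℝ l) → (∀ i → x i ∈ D) →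
    z ∈ sumDifferenceSet m n A → z - sum x ∈ sumDifferenceSet (l ℕ.+ m) (l ℕ.+ n) A
  Δ---sum {m} {n} {zero} {z} x x∈D z∈ = sumDifferenceSet-resp-≈ {m} {n} {A} {z - 0ℝ} {z}
    (≈-pointwise {z - 0ℝ} {z} λ n → ℚₚ.+-identityʳ (seq z n)) z∈
  Δ---sum {m} {n} {suc l} {z} x x∈D z∈ =
    sumDifferenceSet-resp-≈ {suc l ℕ.+ m} {suc l ℕ.+ n} {A} {z - (x₀ + sum x′)} {z - sum x′ - x₀}
      (≈-pointwise {z - (x₀ + sum x′)} {z - sum x′ - x₀} λ n →
        solve 3 (λ z x s → z :- (x :+ s) := (z :- s) :- x) refl (seq z n) (seq x₀ n) (seq (sum x′) n))
      (Δ-- {l ℕ.+ m} {l ℕ.+ n} {x₀} {z - sum x′} (x∈D Fin.zero)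
        (Δ---sum {m} {n} {l} {z} x′ (x∈D ∘ Fin.suc) z∈))
    where
    x₀ = x Fin.zero
    x′ = x ∘ Fin.suc

  -- The term `a i` costs one summand, and each of the 2n+1 differences in `z`, added or subtracted,
  -- costs one summand and one subtrahend. This makes 2n+2 summands and 2n+1 subtrahends.
  sumDifferenceSet-Δ : ∀ {n z} i → z ∈ sumDifferenceSet (suc n) n D →
    a i + z ∈ sumDifferenceSet (suc n ℕ.+ suc n) (n ℕ.+ suc n) A
  sumDifferenceSet-Δ {n} {z} i (x , y , x∈D , y∈D , z≈) =
    subst₂ (λ p q → (a i + z) ∈ sumDifferenceSet p q A) (count₁ n) (count₂ n)
    (sumDifferenceSet-resp-≈ {n ℕ.+ (suc n ℕ.+ 1)} {n ℕ.+ (suc n ℕ.+ 0)} {A} {a i + z} {a i + sum x - sum y}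
      (≈-transport {z} {sum x - sum y} {a i + z} {a i + sum x - sum y}
        (λ n → solve 4 (λ a z x y → z :- (x :- y) := (a :+ z) :- ((a :+ x) :- y)) refl
          (seq (a i) n) (seq z n) (seq (sum x) n) (seq (sum y) n)) z≈)
      (Δ---sum {suc n ℕ.+ 1} {suc n ℕ.+ 0} {n} {a i + sum x} y y∈D
        (Δ-+-sum {1} {0} {suc n} {a i} x x∈D (elements⊆sumDifferenceSet i))))
    where
    count₁ : ∀ n → n ℕ.+ (suc n ℕ.+ 1) ≡ suc n ℕ.+ suc n
    count₁ = ℕSolver.solve-∀
    count₂ : ∀ n → n ℕ.+ (suc n ℕ.+ 0) ≡ n ℕ.+ suc n
    count₂ = ℕSolver.solve-∀

-- Counting elements of a set in an interval

-- Half-open intervals (lo , hi] keep packings of adjacent intervals disjoint, so that their counts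
-- add.
Packing : SetOfReals → ℕ → ℝ → ℝ → Set
Packing S n lo hi = ∃ λ (z : Vector ℝ n) →
  (∀ i → z i ∈ S × lo < z i × z i ≤ hi) × (∀ i j → z i ≈ z j → i ≡ j)

packing-mono : ∀ {S T n lo hi} → S ⊆ T → Packing S n lo hi → Packing T n lo hi
packing-mono S⊆T (z , bounds , inj) =
  z , (λ i → let z∈S , lohi = bounds i in S⊆T z∈S , lohi) , inj

packing-single : ∀ {S lo hi} → hi ∈ S → lo < hi → Packing S 1 lo hi
packing-single {hi = hi} hi∈S lo<hi =
  (λ _ → hi) , (λ _ → hi∈S , lo<hi , <-irrefl {hi}) , λ { Fin.zero Fin.zero _ → refl }

-- The first hypothesis says lo ≤ mid; as _≤_ is a negation, lo < z would not
-- follow constructively from it and mid < z.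
packing-++ : ∀ {S m n lo mid hi} → (∀ {z} → mid < z → lo < z) → mid < hi →
  Packing S m lo mid → Packing S n mid hi → Packing S (m ℕ.+ n) lo hi
packing-++ {S} {m} {n} {lo} {mid} {hi} lo≤mid mid<hi (x , x-bounds , x-inj) (y , y-bounds , y-inj) =
  x ++ y , (λ i → bounds (splitAt m i)) , λ i j eq → begin
    i                        ≡⟨ Finₚ.join-splitAt m n i ⟨
    join m n (splitAt m i)   ≡⟨ cong (join m n) (injective (splitAt m i) (splitAt m j) eq) ⟩
    join m n (splitAt m j)   ≡⟨ Finₚ.join-splitAt m n j ⟩
    j                        ∎
  where
  open ≡-Reasoning
  xy : Fin m ⊎ Fin n → ℝ
  xy = [ x , y ]′
  bounds : ∀ s → xy s ∈ S × lo < xy s × xy s ≤ hi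
  bounds (inj₁ i) = let x∈S , lo<x , x≤mid = x-bounds i in
    x∈S , lo<x , λ hi<x → x≤mid (<-trans {mid} {hi} {x i} mid<hi hi<x)
  bounds (inj₂ j) = let y∈S , mid<y , y≤hi = y-bounds j in
    y∈S , lo≤mid {y j} mid<y , y≤hi
  separated : ∀ i j → ¬ x i ≈ y j
  separated i j eq = let _ , _ , x≤mid = x-bounds i
                         _ , mid<y , _ = y-bounds j
    in x≤mid (<-respʳ-≈ {mid} {y j} {x i} (≈-sym {x i} {y j} eq) mid<y)
  injective : ∀ s t → xy s ≈ xy t → s ≡ t
  injective (inj₁ i) (inj₁ j) eq = cong inj₁ (x-inj i j eq)
  injective (inj₁ i) (inj₂ j) eq = contradiction eq (separated i j)
  injective (inj₂ i) (inj₁ j) eq = contradiction (≈-sym {y i} {x j} eq) (separated j i)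
  injective (inj₂ i) (inj₂ j) eq = cong inj₂ (y-inj i j eq)

-- Points above a positive `lo` are themselves positive, so their translates by `x` lie above `x`.
packing-translate : ∀ {S T n lo x y} → (∀ {z} → z ∈ S → x + z ∈ T) → 0ℝ < lo →
  Packing S n lo (y - x) → Packing T n x y
packing-translate {lo = lo} {x} {y} S+x⊆T 0<lo (z , bounds , inj) =
  (λ i → x + z i) ,
  (λ i → let z∈S , lo<z , z≤ = bounds i in
    S+x⊆T z∈S , 0<y⇒x<x+y x {z i} (<-trans {0ℝ} {lo} {z i} 0<lo lo<z) ,
    λ y< → z≤ (y<x+z⇒y-x<z x {y} {z i} y<)) ,
  λ i j eq → inj i j (+-cancelˡ {z i} {z j} x eq)

-- Convexity of initial segments

IsConvex-empty : ∀ k (a : Vector ℝ 0) → IsConvex k a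
IsConvex-empty zero    a = λ ()
IsConvex-empty (suc k) a = (λ ()) , IsConvex-empty k (Δ a)

Δ-≡ : ∀ {N} (a : Vector ℝ (suc N)) i {x y} → a (inject₁ i) ≡ x → a (Fin.suc i) ≡ y → Δ a i ≡ y - x
Δ-≡ a i refl refl = refl

Δ-cong : ∀ {N} {a b : Vector ℝ N} → (∀ i → a i ≡ b i) → ∀ i → Δ a i ≡ Δ b i
Δ-cong {suc N} {a} {b} eq i = Δ-≡ a i {b (inject₁ i)} {b (Fin.suc i)} (eq (inject₁ i)) (eq (Fin.suc i))

Δ-init : ∀ {N} (a : Vector ℝ (suc (suc N))) i → init (Δ a) i ≡ Δ (init a) i
Δ-init a i = Δ-≡ a (inject₁ i) {init a (inject₁ i)} {init a (Fin.suc i)} refl refl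

StrictlyIncreasing-cong : ∀ {N} {a b : Vector ℝ N} →
  (∀ i → a i ≡ b i) → StrictlyIncreasing a → StrictlyIncreasing b
StrictlyIncreasing-cong eq inc i j i<j = subst₂ _<_ (eq i) (eq j) (inc i j i<j)

-- Vectors are functions, so convexity is carried along pointwise equality; this takes it from
-- `init (Δ a)` to `Δ (init a)`.
IsConvex-cong : ∀ k {N} {a b : Vector ℝ N} → (∀ i → a i ≡ b i) → IsConvex k a → IsConvex k b
IsConvex-cong zero    {a = a} {b} eq inc = StrictlyIncreasing-cong {a = a} {b} eq inc
IsConvex-cong (suc k) {a = a} {b} eq (inc , convex) =
  StrictlyIncreasing-cong {a = a} {b} eq inc ,
  IsConvex-cong k {a = Δ a} {Δ b} (Δ-cong {a = a} {b} eq) convex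

StrictlyIncreasing-init : ∀ {N} (a : Vector ℝ (suc N)) →
  StrictlyIncreasing a → StrictlyIncreasing (init a)
StrictlyIncreasing-init a inc i j i<j = inc (inject₁ i) (inject₁ j)
  (subst₂ ℕ._<_ (sym (Finₚ.toℕ-inject₁ i)) (sym (Finₚ.toℕ-inject₁ j)) i<j)

-- Dropping the last term commutes with taking differences, which allows induction on `k`. A
-- one-term sequence is split off because `Δ-init` speaks of at least two terms.
IsConvex-init : ∀ k {N} (a : Vector ℝ (suc N)) → IsConvex k a → IsConvex k (init a)
IsConvex-init k       {zero}  a _   = IsConvex-empty k (init a)
IsConvex-init zero    {suc N} a inc = StrictlyIncreasing-init a inc
IsConvex-init (suc k) {suc N} a (inc , convex) =
  StrictlyIncreasing-init a inc ,
  IsConvex-cong k {a = init (Δ a)} {Δ (init a)} (Δ-init a) (IsConvex-init k (Δ a) convex)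

IsConvex⇒increasing : ∀ k {N} (a : Vector ℝ N) → IsConvex k a → StrictlyIncreasing a
IsConvex⇒increasing zero    a inc       = inc
IsConvex⇒increasing (suc k) a (inc , _) = inc

elements-init : ∀ {N} (a : Vector ℝ (suc N)) → elements (init a) ⊆ elements a
elements-init a (i , x≈) = inject₁ i , x≈

-- The weak inequality in the form that `packing-++` takes; for a single term the two ends coincide.
head≤last : ∀ {M} (a : Vector ℝ (suc M)) → StrictlyIncreasing a →
  ∀ {z} → last a < z → a Fin.zero < z
head≤last {zero}  a inc         last<z = last<z
head≤last {suc M} a inc {z} last<z =
  <-trans {a Fin.zero} {last a} {z} (inc Fin.zero (Fin.fromℕ (suc M)) (s≤s z≤n)) last<z

init-last<last : ∀ {M} (a : Vector ℝ (suc (suc M))) → StrictlyIncreasing a → last (init a) < last a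
init-last<last {M} a inc = inc _ _ (s≤s (ℕₚ.≤-reflexive (Finₚ.toℕ-inject₁ (Fin.fromℕ M))))

-- The induction on the order of convexity and the length

packing-snoc : ∀ k {M m n} (a : Vector ℝ (suc (suc M))) → IsConvex k a →
  Packing (sumDifferenceSet (2 ^ k) (2 ^ k ∸ 1) (elements (init a))) m (a Fin.zero) (last (init a)) →
  Packing (sumDifferenceSet (2 ^ k) (2 ^ k ∸ 1) (elements a)) n (last (init a)) (last a) →
  Packing (sumDifferenceSet (2 ^ k) (2 ^ k ∸ 1) (elements a)) (m ℕ.+ n) (a Fin.zero) (last a)
packing-snoc k {M} {m} {n} a convex p q =
  packing-++ {S} {m} {n} {a Fin.zero} {last (init a)} {last a}
    (λ {z} → head≤last (init a) (StrictlyIncreasing-init a inc) {z})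
    (init-last<last a inc)
    (packing-mono {S′} {S} {m} {a Fin.zero} {last (init a)}
      (λ {z} → sumDifferenceSet-mono {2 ^ k} {2 ^ k ∸ 1} {elements (init a)} {elements a}
        (λ {x} → elements-init a {x}) {z})
      p)
    q
  where
  S   = sumDifferenceSet (2 ^ k) (2 ^ k ∸ 1) (elements a)
  S′  = sumDifferenceSet (2 ^ k) (2 ^ k ∸ 1) (elements (init a))
  inc = IsConvex⇒increasing k a convex

-- The passage from 2ᵏ to 2ᵏ⁺¹. Since `m` is positive, `m ∸ 1` and `2 ℕ.* m ∸ 1` are true
-- subtractions, and the counts of `sumDifferenceSet-Δ` fit with n = m - 1.
sumDifferenceSet-Δ-double : ∀ m {N} (a : Vector ℝ (suc N)) i {z} → 0 ℕ.< m →
  z ∈ sumDifferenceSet m (m ∸ 1) (elements (Δ a)) →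
  a i + z ∈ sumDifferenceSet (2 ℕ.* m) (2 ℕ.* m ∸ 1) (elements a)
sumDifferenceSet-Δ-double (suc n) a i {z} _ z∈ =
  -- `2 ℕ.* suc n` unfolds to `suc n ℕ.+ (suc n ℕ.+ 0)`; the trailing zero is restored here.
  subst (λ p → a i + z ∈ sumDifferenceSet (suc n ℕ.+ p) (n ℕ.+ p) (elements a))
    (sym (ℕₚ.+-identityʳ (suc n))) (sumDifferenceSet-Δ a {n} {z} i z∈)

-- The last difference is the length of the last interval, so translating by `last (init a)` fills
-- exactly that interval.
packing-Δ : ∀ k {M n lo} (a : Vector ℝ (suc (suc M))) → 0ℝ < lo →
  Packing (sumDifferenceSet (2 ^ k) (2 ^ k ∸ 1) (elements (Δ a))) n lo (last (Δ a)) →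
  Packing (sumDifferenceSet (2 ^ suc k) (2 ^ suc k ∸ 1) (elements a)) n (last (init a)) (last a)
packing-Δ k {M} {n} {lo} a 0<lo p = packing-translate
  {S} {T} {n} {lo} {last (init a)} {last a}
  (λ {z} → sumDifferenceSet-Δ-double (2 ^ k) a (inject₁ (Fin.fromℕ M)) {z} (ℕₚ.m^n>0 2 k))
  0<lo
  (subst (Packing S n lo) (Δ-≡ a (Fin.fromℕ M) {last (init a)} {last a} refl refl) p)
  where
  S = sumDifferenceSet (2 ^ k) (2 ^ k ∸ 1) (elements (Δ a))
  T = sumDifferenceSet (2 ^ suc k) (2 ^ suc k ∸ 1) (elements a)

Δ-positive : ∀ {M} (a : Vector ℝ (suc M)) → StrictlyIncreasing a → ∀ i → 0ℝ < Δ a i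
Δ-positive a inc i = x<y⇒0<y-x {a (inject₁ i)} {a (Fin.suc i)}
  (inc (inject₁ i) (Fin.suc i) (s≤s (ℕₚ.≤-reflexive (Finₚ.toℕ-inject₁ i))))

convex-packing : ∀ k {M} (a : Vector ℝ (suc M)) → IsConvex k a →
  Packing (sumDifferenceSet (2 ^ k) (2 ^ k ∸ 1) (elements a)) (M C suc k) (a Fin.zero) (last a)
-- One term spans no interval, and C(0, k+1) = 0.
convex-packing k       {zero}  a convex = (λ ()) , (λ ()) , λ ()
-- For k = 0 the set is 1A - 0A, that is A, and each interval contributes its right endpoint.
convex-packing zero    {suc M} a inc =
  subst (λ n → Packing S n (a Fin.zero) (last a))
    (trans (ℕₚ.+-comm (M C 1) 1) (nCk+nC[k+1]≡[n+1]C[k+1] M 0))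
    (packing-snoc 0 a inc
      (convex-packing 0 (init a) (StrictlyIncreasing-init a inc))
      (packing-single {S} {last (init a)} {last a} (elements⊆sumDifferenceSet a (Fin.fromℕ (suc M)))
        (init-last<last a inc)))
  where S = sumDifferenceSet 1 0 (elements a)
convex-packing (suc k) {suc M} a convex =
  subst (λ n → Packing S n (a Fin.zero) (last a))
    (trans (ℕₚ.+-comm (M C suc (suc k)) (M C suc k)) (nCk+nC[k+1]≡[n+1]C[k+1] M (suc k)))
    (packing-snoc (suc k) a convex
      (convex-packing (suc k) (init a) (IsConvex-init (suc k) a convex))
      -- The packing for `Δ a` starts at the first difference, which is positive since `a`
      -- increases.
      (packing-Δ k {lo = Δ a Fin.zero} a (Δ-positive a (proj₁ convex) Fin.zero)
        (convex-packing k (Δ a) (proj₂ convex))))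
  where S = sumDifferenceSet (2 ^ suc k) (2 ^ suc k ∸ 1) (elements a)

-- Lower bounds for binomial coefficients

-- The absorption identity. Pascal's rule splits the left side, `expand` sets one copy of C(n+1,
-- k+1) aside, the induction hypotheses treat the rest, and Pascal's rule joins it again.
[1+k]*[1+n]C[1+k]≡[1+n]*nCk : ∀ n k → suc k ℕ.* (suc n C suc k) ≡ suc n ℕ.* (n C k)
[1+k]*[1+n]C[1+k]≡[1+n]*nCk n       zero    = begin
  1 ℕ.* (suc n C 1)  ≡⟨ ℕₚ.*-identityˡ _ ⟩
  suc n C 1          ≡⟨ nC1≡n (suc n) ⟩
  suc n              ≡⟨ ℕₚ.*-identityʳ (suc n) ⟨
  suc n ℕ.* 1        ∎
  where open ≡-Reasoning
[1+k]*[1+n]C[1+k]≡[1+n]*nCk zero    (suc k) = ℕₚ.*-zeroʳ (suc (suc k))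
[1+k]*[1+n]C[1+k]≡[1+n]*nCk (suc n) (suc k) = begin
  suc (suc k) ℕ.* (suc (suc n) C suc (suc k))
    ≡⟨ cong (suc (suc k) ℕ.*_) (nCk+nC[k+1]≡[n+1]C[k+1] (suc n) (suc k)) ⟨
  suc (suc k) ℕ.* ((suc n C suc k) ℕ.+ (suc n C suc (suc k)))
    ≡⟨ expand (suc k) (suc n C suc k) (suc n C suc (suc k)) ⟩
  (suc n C suc k) ℕ.+ (suc k ℕ.* (suc n C suc k) ℕ.+ suc (suc k) ℕ.* (suc n C suc (suc k)))
    ≡⟨ cong ((suc n C suc k) ℕ.+_) (cong₂ ℕ._+_
         ([1+k]*[1+n]C[1+k]≡[1+n]*nCk n k) ([1+k]*[1+n]C[1+k]≡[1+n]*nCk n (suc k))) ⟩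
  (suc n C suc k) ℕ.+ (suc n ℕ.* (n C k) ℕ.+ suc n ℕ.* (n C suc k))
    ≡⟨ cong ((suc n C suc k) ℕ.+_) (ℕₚ.*-distribˡ-+ (suc n) (n C k) (n C suc k)) ⟨
  (suc n C suc k) ℕ.+ suc n ℕ.* ((n C k) ℕ.+ (n C suc k))
    ≡⟨ cong (λ c → (suc n C suc k) ℕ.+ suc n ℕ.* c) (nCk+nC[k+1]≡[n+1]C[k+1] n k) ⟩
  suc (suc n) ℕ.* (suc n C suc k) ∎
  where
  open ≡-Reasoning
  expand : ∀ k a b → suc k ℕ.* (a ℕ.+ b) ≡ a ℕ.+ (k ℕ.* a ℕ.+ suc k ℕ.* b)
  expand = ℕSolver.solve-∀

^-distribʳ-* : ∀ m n o → (m ℕ.* n) ^ o ≡ m ^ o ℕ.* n ^ o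
^-distribʳ-* m n zero    = refl
^-distribʳ-* m n (suc o) =
  trans (cong (m ℕ.* n ℕ.*_) (^-distribʳ-* m n o)) (rearrange m n (m ^ o) (n ^ o))
  where
  rearrange : ∀ a b c d → a ℕ.* b ℕ.* (c ℕ.* d) ≡ a ℕ.* c ℕ.* (b ℕ.* d)
  rearrange = ℕSolver.solve-∀

-- C(n,k) is the product of the (n−j)/(k−j) over j < k, and each factor is at
-- least (n+1)/(k+1).
[1+n]^k≤[1+k]^k*nCk : ∀ {n k} → k ≤ℕ n → suc n ^ k ≤ℕ suc k ^ k ℕ.* (n C k)
[1+n]^k≤[1+k]^k*nCk {n}         {zero}      _       = ℕₚ.≤-refl
[1+n]^k≤[1+k]^k*nCk {n@(suc n′)} {k@(suc k′)} (s≤s k≤n) =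
  -- The factor `k ^ k` clears the denominators of the k ratios (n+1)/n ≤ (k+1)/k that lead to the
  -- induction hypothesis at `n′`, `k′`.
  ℕₚ.*-cancelˡ-≤ (k ^ k) {{m^n≢0 k k}} (begin
  k ^ k ℕ.* suc n ^ k                          ≡⟨ ^-distribʳ-* k (suc n) k ⟨
  (k ℕ.* suc n) ^ k                            ≤⟨ ℕₚ.^-monoˡ-≤ k ratio ⟩
  (suc k ℕ.* n) ^ k                            ≡⟨ ^-distribʳ-* (suc k) n k ⟩
  suc k ^ k ℕ.* (n ℕ.* n ^ k′)                 ≤⟨ ℕₚ.*-monoʳ-≤ (suc k ^ k) (ℕₚ.*-monoʳ-≤ n ([1+n]^k≤[1+k]^k*nCk k≤n)) ⟩
  suc k ^ k ℕ.* (n ℕ.* (k ^ k′ ℕ.* (n′ C k′))) ≡⟨ pull (suc k ^ k) n (k ^ k′) (n′ C k′) ⟩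
  suc k ^ k ℕ.* k ^ k′ ℕ.* (n ℕ.* (n′ C k′))   ≡⟨ cong (suc k ^ k ℕ.* k ^ k′ ℕ.*_) ([1+k]*[1+n]C[1+k]≡[1+n]*nCk n′ k′) ⟨
  suc k ^ k ℕ.* k ^ k′ ℕ.* (k ℕ.* (n C k))     ≡⟨ push (suc k ^ k) (k ^ k′) k (n C k) ⟩
  k ^ k ℕ.* (suc k ^ k ℕ.* (n C k))            ∎)
  where
  open ℕₚ.≤-Reasoning
  ratio : k ℕ.* suc n ≤ℕ suc k ℕ.* n
  ratio = begin
    k ℕ.* suc n    ≡⟨ ℕₚ.*-suc k n ⟩
    k ℕ.+ k ℕ.* n  ≤⟨ ℕₚ.+-monoˡ-≤ (k ℕ.* n) (s≤s k≤n) ⟩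
    suc k ℕ.* n    ∎
  pull : ∀ a b c d → a ℕ.* (b ℕ.* (c ℕ.* d)) ≡ a ℕ.* c ℕ.* (b ℕ.* d)
  pull = ℕSolver.solve-∀
  push : ∀ a b c d → a ℕ.* b ℕ.* (c ℕ.* d) ≡ c ℕ.* b ℕ.* (a ℕ.* d)
  push = ℕSolver.solve-∀

-- For k ≥ 4, 2+k ≤ 2^(k-1) and (k-1)(k+1) = k² - 1. The cases 2 and 3 are numerical; at k = 2 both
-- sides equal 64, which fixes the constant 4.
[2+k]^[1+k]≤4*2^k² : ∀ {k} → 2 ≤ℕ k → (2 ℕ.+ k) ^ suc k ≤ℕ 4 ℕ.* 2 ^ (k ^ 2)
[2+k]^[1+k]≤4*2^k² {1} (s≤s ())
[2+k]^[1+k]≤4*2^k² {2} _ = ℕₚ.≤-refl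
[2+k]^[1+k]≤4*2^k² {3} _ = ℕₚ.≤ᵇ⇒≤ 625 2048 _
[2+k]^[1+k]≤4*2^k² {k@(suc (suc (suc (suc j))))} _ = begin
  (2 ℕ.+ k) ^ suc k          ≤⟨ ℕₚ.^-monoˡ-≤ (suc k) (6+j≤2^[3+j] j) ⟩
  (2 ^ (3 ℕ.+ j)) ^ suc k    ≡⟨ ℕₚ.^-*-assoc 2 (3 ℕ.+ j) (suc k) ⟩
  2 ^ ((3 ℕ.+ j) ℕ.* suc k)  ≤⟨ ℕₚ.^-monoʳ-≤ 2 (ℕₚ.≤-trans (ℕₚ.n≤1+n _) (ℕₚ.≤-reflexive (difference-of-squares j))) ⟩
  2 ^ (k ^ 2)                ≤⟨ ℕₚ.m≤n*m (2 ^ (k ^ 2)) 4 ⟩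
  4 ℕ.* 2 ^ (k ^ 2)          ∎
  where
  open ℕₚ.≤-Reasoning
  difference-of-squares : ∀ j → suc ((3 ℕ.+ j) ℕ.* (5 ℕ.+ j)) ≡ (4 ℕ.+ j) ℕ.* ((4 ℕ.+ j) ℕ.* 1)
  difference-of-squares = ℕSolver.solve-∀
  6+j≤2^[3+j] : ∀ j → 6 ℕ.+ j ≤ℕ 2 ^ (3 ℕ.+ j)
  6+j≤2^[3+j] zero    = ℕₚ.≤ᵇ⇒≤ 6 8 _
  6+j≤2^[3+j] (suc j) = ℕₚ.+-mono-≤ {1} {2 ^ (3 ℕ.+ j)} {6 ℕ.+ j} (ℕₚ.m^n>0 2 (3 ℕ.+ j))
    (ℕₚ.≤-trans (6+j≤2^[3+j] j) (ℕₚ.m≤m+n (2 ^ (3 ℕ.+ j)) 0))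

[1+n]^[1+k]≤4*2^k²*nC[1+k] : ∀ {n k} → 2 ≤ℕ k → suc k ≤ℕ n →
  suc n ^ suc k ≤ℕ 4 ℕ.* 2 ^ (k ^ 2) ℕ.* (n C suc k)
[1+n]^[1+k]≤4*2^k²*nC[1+k] {n} {k} 2≤k k<n =
  ℕₚ.≤-trans ([1+n]^k≤[1+k]^k*nCk k<n) (ℕₚ.*-monoˡ-≤ (n C suc k) ([2+k]^[1+k]≤4*2^k² 2≤k))

-- Here C(n, k+1) = 0, but the sequence is so short that a single element meets the bound.
[1+n]^[1+k]≤4*2^k²*1 : ∀ {n k} → 2 ≤ℕ k → n ℕ.< suc k → suc n ^ suc k ≤ℕ 4 ℕ.* 2 ^ (k ^ 2) ℕ.* 1
[1+n]^[1+k]≤4*2^k²*1 {n} {k} 2≤k n<1+k = begin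
  suc n ^ suc k            ≤⟨ ℕₚ.^-monoˡ-≤ (suc k) (ℕₚ.m≤n⇒m≤1+n n<1+k) ⟩
  (2 ℕ.+ k) ^ suc k        ≤⟨ [2+k]^[1+k]≤4*2^k² 2≤k ⟩
  4 ℕ.* 2 ^ (k ^ 2)        ≡⟨ ℕₚ.*-identityʳ _ ⟨
  4 ℕ.* 2 ^ (k ^ 2) ℕ.* 1  ∎
  where open ℕₚ.≤-Reasoning

-- From natural-number counts to the real bound

toℚᵘ-/ : ∀ p d .{{_ : ℕ.NonZero d}} → toℚᵘ (p / d) ℚᵘ.≃ p ℚᵘ./ d
toℚᵘ-/ p (suc d) = ℚₚ.toℚᵘ-fromℚᵘ (ℚᵘ.mkℚᵘ p d)

-- Fractions in ℚ are kept in lowest terms, so the comparison is made on unnormalised ones, where it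
-- is the cross-multiplied p ≤ n · 4d.
¼*p/d≤n : ∀ p d n .{{_ : ℕ.NonZero d}} → p ≤ℕ 4 ℕ.* d ℕ.* n → (+ 1 / 4) ℚ.* (+ p / d) ℚ.≤ + n / 1
¼*p/d≤n p d@(suc d′) n p≤ = ℚₚ.toℚᵘ-cancel-≤ (begin
  toℚᵘ ((+ 1 / 4) ℚ.* (+ p / d))       ≃⟨ ℚₚ.toℚᵘ-homo-* (+ 1 / 4) (+ p / d) ⟩
  toℚᵘ (+ 1 / 4) ℚᵘ.* toℚᵘ (+ p / d)   ≃⟨ ℚᵘₚ.*-congˡ {toℚᵘ (+ 1 / 4)} (toℚᵘ-/ (+ p) d) ⟩
  (+ 1 ℚᵘ./ 4) ℚᵘ.* (+ p ℚᵘ./ d)       ≤⟨ ℚᵘ.*≤* cross ⟩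
  + n ℚᵘ./ 1                           ≃⟨ toℚᵘ-/ (+ n) 1 ⟨
  toℚᵘ (+ n / 1)                       ∎)
  where
  open ℚᵘₚ.≤-Reasoning
  cross : + 1 ℤ.* + p ℤ.* + 1 ℤ.≤ + n ℤ.* + (4 ℕ.* d)
  cross = subst₂ ℤ._≤_
    (sym (trans (ℤₚ.*-identityʳ (+ 1 ℤ.* + p)) (ℤₚ.*-identityˡ (+ p))))
    (trans (cong +_ (ℕₚ.*-comm (4 ℕ.* d) n)) (ℤₚ.pos-* n (4 ℕ.* d)))
    (ℤ.+≤+ p≤)

-- A product of constant sequences is constant, so a gap refuting the conclusion would be a strict
-- inequality r < pq of rationals.
fromℚ-*-≤ : ∀ {p q r} → p ℚ.* q ℚ.≤ r → fromℚ p * fromℚ q ≤ fromℚ r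
fromℚ-*-≤ {p} {q} {r} pq≤r (ε , 0<ε , M , gap) = ℚₚ.<-irrefl refl
  (ℚₚ.<-≤-trans (fromℚ-cancel-< {r} {p ℚ.* q} (ε , 0<ε , M , gap)) pq≤r)

packing⇒injection : ∀ {S n lo hi} → Packing S n lo hi → Injection (setoid (Fin n)) (subsetSetoid S)
packing⇒injection (z , bounds , inj) = record
  { to        = λ i → z i , proj₁ (bounds i)
  ; cong      = λ { {i} refl → ≈-refl {z i} }
  ; injective = λ {i} {j} → inj i j
  }

inhabited⇒injection : ∀ {S x} → x ∈ S → Injection (setoid (Fin 1)) (subsetSetoid S)
inhabited⇒injection {x = x} x∈S = record
  { to        = λ _ → x , x∈S
  ; cong      = λ _ → ≈-refl {x}
  ; injective = λ { {Fin.zero} {Fin.zero} _ → refl }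
  }

sumDifferenceSet-inhabited : ∀ {A x} m n → x ∈ A → ∃ λ z → z ∈ sumDifferenceSet m n A
sumDifferenceSet-inhabited {x = x} m n x∈A =
  sum {m} (λ _ → x) - sum {n} (λ _ → x) ,
  (λ _ → x) , (λ _ → x) , (λ _ → x∈A) , (λ _ → x∈A) , ≈-refl {sum {m} (λ _ → x) - sum {n} (λ _ → x)}

packing-or-single : ∀ {S lo hi x k M} → 2 ≤ℕ k → Packing S (M C suc k) lo hi → x ∈ S →
  suc k ≤ℕ M ⊎ M ℕ.< suc k →
  ∃ λ n → suc M ^ suc k ≤ℕ 4 ℕ.* 2 ^ (k ^ 2) ℕ.* n × Injection (setoid (Fin n)) (subsetSetoid S)
packing-or-single {S} {lo} {hi} {k = k} {M} 2≤k packing x∈S (inj₁ k<M) =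
  M C suc k , [1+n]^[1+k]≤4*2^k²*nC[1+k] {M} {k} 2≤k k<M , packing⇒injection {S} {M C suc k} {lo} {hi} packing
packing-or-single {S} {x = x} {k} {M} 2≤k packing x∈S (inj₂ M<1+k) =
  1 , [1+n]^[1+k]≤4*2^k²*1 {M} {k} 2≤k M<1+k , inhabited⇒injection {S} {x} x∈S

convex-injection : ∀ k → 2 ≤ℕ k → ∀ N (a : Vector ℝ N) → IsConvex k a →
  ∃ λ n → N ^ suc k ≤ℕ 4 ℕ.* 2 ^ (k ^ 2) ℕ.* n ×
    Injection (setoid (Fin n)) (subsetSetoid (sumDifferenceSet (2 ^ k) (2 ^ k ∸ 1) (elements a)))
convex-injection k 2≤k zero    a convex =
  -- The bound vanishes for the empty sequence, as 0 is raised to the positive power k+1.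
  0 , z≤n , record { to = λ () ; cong = λ { {()} } ; injective = λ { {()} } }
convex-injection k 2≤k (suc M) a convex = packing-or-single
  {sumDifferenceSet (2 ^ k) (2 ^ k ∸ 1) (elements a)} {a Fin.zero} {last a} {proj₁ z∈S} {k} {M}
  2≤k (convex-packing k a convex) (proj₂ z∈S) (ℕₚ.≤-<-connex (suc k) M)
  where
  z∈S = sumDifferenceSet-inhabited {elements a} {a Fin.zero} (2 ^ k) (2 ^ k ∸ 1)
    (Fin.zero , ≈-refl {a Fin.zero})

theorem3 : ∃ λ (c : ℝ) → 0ℝ < c × (∀ (k : ℕ) → 2 ≤ℕ k → ∀ (N : ℕ) (a : Vector ℝ N) → IsConvex k a →
    ∣ sumDifferenceSet (2 ^ k) (2 ^ k ∸ 1) (elements a) ∣≥ c * fromℚ (_/_ (+ (N ^ suc k)) (2 ^ (k ^ 2)) {{m^n≢0 2 (k ^ 2)}}))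
-- c = 1/4 is the reciprocal of the 4 in the counting bound; 1/4 also serves as the gap witnessing 0
-- < c.
theorem3 = fromℚ (+ 1 / 4) , (+ 1 / 4 , ℚₚ.positive⁻¹ (+ 1 / 4) , 0 , λ _ _ → ℚₚ.≤-refl) ,
  λ k 2≤k N a convex →
    let instance _ = m^n≢0 2 (k ^ 2)
        n , N^[1+k]≤ , injection = convex-injection k 2≤k N a convex
    in n ,
       fromℚ-*-≤ {+ 1 / 4} {+ (N ^ suc k) / (2 ^ (k ^ 2))} {+ n / 1}
         (¼*p/d≤n (N ^ suc k) (2 ^ (k ^ 2)) n N^[1+k]≤) ,
       injection
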